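{- Let $c\ge 1$ and $t \ge 1$ be integers and let $G$ be a graph on $n$ vertices which is the complement of a $c$-closed graph. Then the number of inclusion-maximal sets $S \subseteq V(G)$ such that $\mathrm{tw}(G[S]) \le t$ is at most $3 n^{t+4} 2^{2(c-1)}$.
   Context: Graphs are finite, simple and undirected. A graph $H$ is $c$-closed if any two non-adjacent vertices of $H$ have at most $c-1$ common neighbors; $G$ is the complement of a $c$-closed graph iff for any two adjacent vertices $u,v$ of $G$ at most $c-1$ vertices of $G$ are adjacent to neither $u$ nor $v$ (excluding $u,v$). $\mathrm{tw}$ denotes treewidth.
   Formalization: The graph is assumed to have at least one vertex (n ≥ 1); for n = 0 the empty set is the one maximal set while the bound 3·n^(t+4)·2^(2(c−1)) equals 0. -}

module Defs where

open import Data.Nat using (ℕ; zero; suc; _+_; _*_; _∸_; _^_; _≤_)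
open import Data.Bool using (Bool; true; false; not; _∧_)
open import Data.Fin using (Fin)
open import Data.Fin.Subset using (Subset; _∈_; _⊆_; ∣_∣)
open import Data.Vec using (tabulate)
open import Data.List using (List; []; _∷_; _++_; [_]; length)
open import Data.List.Relation.Unary.Linked using (Linked)
open import Data.List.Relation.Unary.Unique.Propositional using (Unique)
open import Data.Product using (Σ; _×_; ∃; ∃-syntax)
open import Relation.Binary.PropositionalEquality using (_≡_)
open import Relation.Nullary using (¬_; does)
open import Data.Fin using (_≟_)

record Graph (n : ℕ) : Set where
  field
    adj    : Fin n → Fin n → Bool
    sym    : ∀ u v → adj u v ≡ adj v u
    irrefl : ∀ v → adj v v ≡ false
open Graph public

complement : ∀ {n} → Graph n → Graph n
complement {n} G = record
  { adj = λ u v → not (adj G u v) ∧ not (does (u ≟ v))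
  ; sym = symC
  ; irrefl = irrC }
  where
  open import Relation.Binary.PropositionalEquality using (cong₂; refl) renaming (sym to ≡-sym)
  open import Relation.Nullary using (yes; no)
  swapDoes : ∀ (u v : Fin n) → does (u ≟ v) ≡ does (v ≟ u)
  swapDoes u v with u ≟ v | v ≟ u
  ... | yes _ | yes _ = refl
  ... | no _  | no _  = refl
  ... | yes p | no q = Data.Empty.⊥-elim (q (≡-sym p)) where import Data.Empty
  ... | no p  | yes q = Data.Empty.⊥-elim (p (≡-sym q)) where import Data.Empty
  symC : ∀ u v → not (adj G u v) ∧ not (does (u ≟ v)) ≡ not (adj G v u) ∧ not (does (v ≟ u))
  symC u v = cong₂ (λ a b → not a ∧ not b) (Graph.sym G u v) (swapDoes u v)
  irrC : ∀ v → not (adj G v v) ∧ not (does (v ≟ v)) ≡ false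
  irrC v with v ≟ v
  ... | yes _ = Data.Bool.Properties.∧-zeroʳ (not (adj G v v)) where import Data.Bool.Properties
  ... | no p = Data.Empty.⊥-elim (p refl) where import Data.Empty

commonNbrs : ∀ {n} → Graph n → Fin n → Fin n → Subset n
commonNbrs G u v = tabulate (λ w → adj G u w ∧ adj G v w)

CClosed : ∀ {n} → ℕ → Graph n → Set
CClosed c H = ∀ u v → ¬ (u ≡ v) → adj H u v ≡ false → ∣ commonNbrs H u v ∣ ≤ c ∸ 1

CoCClosed : ∀ {n} → ℕ → Graph n → Set
CoCClosed c G = Σ (Graph _) λ H → CClosed c H × (G ≡ complement H)

data Walk {V : Set} (E : V → V → Set) : V → V → Set where
  []  : ∀ {u} → Walk E u u
  _∷_ : ∀ {u v w} → E u v → Walk E v w → Walk E u w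

Edge : ∀ {m} → Graph m → Fin m → Fin m → Set
Edge T u v = adj T u v ≡ true

EdgeIn : ∀ {m} → Graph m → (Fin m → Set) → Fin m → Fin m → Set
EdgeIn T P u v = P u × P v × Edge T u v

Connected : ∀ {m} → Graph m → Set
Connected T = ∀ u v → Walk (Edge T) u v

IsCycle : ∀ {m} → Graph m → List (Fin m) → Set
IsCycle T [] = Data.Empty.⊥ where import Data.Empty
IsCycle T (x ∷ xs) = (3 ≤ length (x ∷ xs)) × Unique (x ∷ xs) × Linked (Edge T) ((x ∷ xs) ++ [ x ])

Acyclic : ∀ {m} → Graph m → Set
Acyclic T = ∀ vs → ¬ IsCycle T vs

IsTree : ∀ {m} → Graph m → Set
IsTree {m} T = (1 ≤ m) × Connected T × Acyclic T

record TreeDecomp {n} (G : Graph n) (S : Subset n) (t : ℕ) : Set where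
  field
    m       : ℕ
    T       : Graph m
    isTree  : IsTree T
    bag     : Fin m → Subset n
    bag⊆S   : ∀ i → bag i ⊆ S
    width   : ∀ i → ∣ bag i ∣ ≤ suc t
    cover   : ∀ v → v ∈ S → ∃[ i ] v ∈ bag i
    edgeCov : ∀ u v → u ∈ S → v ∈ S → adj G u v ≡ true → ∃[ i ] (u ∈ bag i × v ∈ bag i)
    subtree : ∀ v → v ∈ S → ∀ i j → v ∈ bag i → v ∈ bag j →
              Walk (EdgeIn T (λ k → v ∈ bag k)) i j

TwLe : ∀ {n} → Graph n → ℕ → Subset n → Set
TwLe G t S = TreeDecomp G S t

MaximalTw : ∀ {n} → Graph n → ℕ → Subset n → Set
MaximalTw {n} G t S = TwLe G t S × (∀ S' → S ⊆ S' → TwLe G t S' → S' ⊆ S)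

{-# OPTIONS --safe #-}
-- Let S be maximal with a tree decomposition of width at most t. If some bag leaves no edge of S
-- outside it, then the bag, possibly enlarged by one vertex, is a set X of at most t + 1 vertices
-- such that every vertex of S ∖ X has a non-neighbour in X. By maximality S ∖ X is then a maximal
-- independent set among all vertices outside X with a non-neighbour in X (hanging such vertices as
-- leaves on X does not increase the width), and a graph as in the theorem has at most
-- 1 + n² 2^(c-1) maximal independent sets. Otherwise each node of the tree points towards an edge
-- of S outside its bag, chosen as a function of the bag. Some two neighbouring nodes point at each
-- other; their bags differ, so they meet in at most t vertices, and each remaining vertex of S is
-- non-adjacent to both ends of one of the two edges, so it lies in one of two sets of size at
-- most c - 1.
module Submission where

open import Defs renaming (sym to adj-sym)
open import Data.Bool using (Bool; true; false; _∧_)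
open import Data.Bool.Properties using (¬-not) renaming (_≟_ to _≟ᵇ_)
open import Data.Empty using (⊥-elim)
open import Data.Fin using (Fin; zero; suc; _≟_)
open import Data.Fin.Properties using (any?; injective⇒≤)
open import Data.Fin.Subset using (Subset; inside; outside; _∈_; _∉_; _⊆_; ∣_∣; ⁅_⁆; _∪_; _∩_; ∁; _-_; Nonempty) renaming (⊥ to ∅)
open import Data.Fin.Subset.Properties
open import Data.List using (List; []; _∷_; _++_; length; map; lookup; concatMap; allFin; filter; [_])
open import Data.List.Properties using (length-map; length-++; length-filter; length-tabulate)
open import Data.List.Membership.Propositional using (lose) renaming (_∈_ to _∈ₗ_)
open import Data.List.Membership.Propositional.Properties using (∈-map⁺; ∈-++⁺ˡ; ∈-++⁺ʳ; ∈-concatMap⁺; ∈-allFin; ∈-lookup; ∈-filter⁺; ∈-filter⁻)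
open import Data.List.Relation.Unary.All as All using (All; []; _∷_)
open import Data.List.Relation.Unary.Any using (here; there; index)
open import Data.List.Relation.Unary.Any.Properties using (lookup-index)
open import Data.List.Relation.Unary.AllPairs using ([]; _∷_)
open import Data.List.Relation.Unary.Unique.Propositional using (Unique)
open import Data.List.Relation.Unary.Unique.Propositional.Properties using (allFin⁺; filter⁺)
open import Data.Nat using (ℕ; zero; suc; _+_; _*_; _∸_; _^_; _≤_; _<_; z≤n; s≤s)
open import Data.Nat.Properties hiding (_≟_)
open import Data.Product using (Σ; _×_; _,_; proj₁; proj₂; ∃-syntax)
open import Data.Sum using (_⊎_; inj₁; inj₂; [_,_]′)
open import Data.Vec using (Vec; []; _∷_; here; tabulate)
open import Function using (_∘_; case_of_)
open import Relation.Binary.PropositionalEquality using (_≡_; _≢_; refl; sym; trans; cong; cong₂; subst)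
open import Relation.Nullary using (¬_; Dec; yes; no; contradiction; does)
open import Relation.Nullary.Decidable using (_×-dec_; ¬?; dec-true)
open import Data.Vec.Properties using (lookup⇒[]=; lookup∘tabulate; []=⇒lookup)
open import Data.List.Membership.DecPropositional using () renaming (_∈?_ to ∈ₗ-dec)
open import Data.List.Relation.Unary.Linked using (Linked; [-]; _∷_)
open import Data.Unit using (⊤; tt)
open import Data.Nat.Solver using (module +-*-Solver)

-- Counting

unique-lookup-injective : {A : Set} {xs : List A} → Unique xs → ∀ {i j} →
  lookup xs i ≡ lookup xs j → i ≡ j
unique-lookup-injective (x∉ ∷ u) {zero}  {zero}  eq = refl
unique-lookup-injective (x∉ ∷ u) {zero}  {suc j} eq = contradiction eq (All.lookup x∉ (∈-lookup j))
unique-lookup-injective (x∉ ∷ u) {suc i} {zero}  eq = contradiction (sym eq) (All.lookup x∉ (∈-lookup i))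
unique-lookup-injective (x∉ ∷ u) {suc i} {suc j} eq = cong suc (unique-lookup-injective u eq)

-- Pigeonhole: the position in `ys` of an entry of `xs` determines the entry and so, without
-- repetitions, its position in `xs`.
unique-⊆-length : {A : Set} {xs ys : List A} → Unique xs → (∀ {x} → x ∈ₗ xs → x ∈ₗ ys) →
  length xs ≤ length ys
unique-⊆-length {xs = xs} {ys} u sub = injective⇒≤ {f = f} inj
  where
  f : Fin (length xs) → Fin (length ys)
  f i = index (sub (∈-lookup {xs = xs} i))
  inj : ∀ {i j} → f i ≡ f j → i ≡ j
  inj {i} {j} eq = unique-lookup-injective u
    (trans (lookup-index (sub (∈-lookup {xs = xs} i)))
      (trans (cong (lookup ys) eq) (sym (lookup-index (sub (∈-lookup {xs = xs} j))))))

-- The covering list may repeat entries and contain elements outside `P`, so these bounds pass to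
-- unions, images and dependent pairs without deciding `P` or equality.
AtMost : {A : Set} → ℕ → (A → Set) → Set
AtMost {A} N P = Σ (List A) λ xs → length xs ≤ N × (∀ {x} → P x → x ∈ₗ xs)

module _ {A : Set} where

  unique-length≤ : ∀ {N} {P : A → Set} → AtMost N P → ∀ {xs} → Unique xs → All P xs → length xs ≤ N
  unique-length≤ (ys , len , cov) u ps =
    ≤-trans (unique-⊆-length u (λ x∈ → cov (All.lookup ps x∈))) len

  atMost-mono : ∀ {M N} {P Q : A → Set} → M ≤ N → (∀ {x} → Q x → P x) → AtMost M P → AtMost N Q
  atMost-mono M≤N Q⇒P (xs , len , cov) = xs , ≤-trans len M≤N , cov ∘ Q⇒P

  atMost-∅ : ∀ {N} {P : A → Set} → (∀ {x} → ¬ P x) → AtMost N P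
  atMost-∅ ¬P = [] , z≤n , λ p → contradiction p ¬P

  atMost-⊎ : ∀ {M N} {P Q : A → Set} → AtMost M P → AtMost N Q → AtMost (M + N) (λ x → P x ⊎ Q x)
  atMost-⊎ (xs , len , cov) (ys , len′ , cov′) =
    xs ++ ys , ≤-trans (≤-reflexive (length-++ xs)) (+-mono-≤ len len′) ,
    λ { (inj₁ p) → ∈-++⁺ˡ (cov p) ; (inj₂ q) → ∈-++⁺ʳ xs (cov′ q) }

  atMost-image : ∀ {B : Set} {N} {P : B → Set} (g : B → A) → AtMost N P →
    AtMost N (λ x → ∃[ y ] (P y × x ≡ g y))
  atMost-image g (ys , len , cov) = map g ys , ≤-trans (≤-reflexive (length-map g ys)) len ,
    λ { (_ , p , refl) → ∈-map⁺ g (cov p) }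

  length-concatMap-≤ : ∀ {B : Set} {N} (f : B → List A) → (∀ y → length (f y) ≤ N) →
    ∀ ys → length (concatMap f ys) ≤ length ys * N
  length-concatMap-≤ f bound []       = z≤n
  length-concatMap-≤ f bound (y ∷ ys) = ≤-trans (≤-reflexive (length-++ (f y)))
    (+-mono-≤ (bound y) (length-concatMap-≤ f bound ys))

  atMost-∃ : ∀ {B : Set} {M N} {Q : B → Set} {P : B → A → Set} →
    AtMost M Q → (∀ y → AtMost N (P y)) → AtMost (M * N) (λ x → ∃[ y ] (Q y × P y x))
  atMost-∃ {M = M} {N} (ys , len , cov) b = concatMap (proj₁ ∘ b) ys ,
    ≤-trans (length-concatMap-≤ (proj₁ ∘ b) (proj₁ ∘ proj₂ ∘ b) ys) (*-monoˡ-≤ N len) ,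
    λ { (y , q , p) → ∈-concatMap⁺ (proj₁ ∘ b) (lose (cov q) (proj₂ (proj₂ (b y)) p)) }

  atMost-∃Fin : ∀ {n N} {P : Fin n → A → Set} → (∀ i → AtMost N (P i)) →
    AtMost (n * N) (λ x → ∃[ i ] P i x)
  atMost-∃Fin {n} {N} b = concatMap (proj₁ ∘ b) (allFin n) ,
    ≤-trans (length-concatMap-≤ (proj₁ ∘ b) (proj₁ ∘ proj₂ ∘ b) (allFin n))
      (*-monoˡ-≤ N (≤-reflexive (length-tabulate {n = n} (λ i → i)))) ,
    λ { (i , p) → ∈-concatMap⁺ (proj₁ ∘ b) (lose (∈-allFin i) (proj₂ (proj₂ (b i)) p)) }

  atMost-∃Vec : ∀ {n N} k {P : Vec (Fin n) k → A → Set} → (∀ xs → AtMost N (P xs)) →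
    AtMost (n ^ k * N) (λ x → ∃[ xs ] P xs x)
  atMost-∃Vec {N = N} zero b =
    atMost-mono (≤-reflexive (sym (*-identityˡ N))) (λ { ([] , p) → p }) (b [])
  atMost-∃Vec {n} {N} (suc k) b =
    atMost-mono (≤-reflexive (sym (*-assoc n (n ^ k) N))) (λ { (i ∷ xs , p) → i , xs , p })
      (atMost-∃Fin (λ i → atMost-∃Vec k (λ xs → b (i ∷ xs))))

atMost-⊆ : ∀ {n} (p : Subset n) → AtMost (2 ^ ∣ p ∣) (_⊆ p)
atMost-⊆ [] = ([] ∷ []) , s≤s z≤n , λ { {[]} _ → here refl }
atMost-⊆ (outside ∷ p) = atMost-mono ≤-refl cover (atMost-image (outside ∷_) (atMost-⊆ p))
  where
  cover : ∀ {q} → q ⊆ outside ∷ p → ∃[ r ] (r ⊆ p × q ≡ outside ∷ r)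
  cover {inside ∷ q}  q⊆ with () ← q⊆ here
  cover {outside ∷ q} q⊆ = q , drop-∷-⊆ q⊆ , refl
atMost-⊆ (inside ∷ p) = atMost-mono (≤-reflexive (cong (2 ^ ∣ p ∣ +_) (sym (+-identityʳ _)))) cover
  (atMost-⊎ (atMost-image (outside ∷_) (atMost-⊆ p)) (atMost-image (inside ∷_) (atMost-⊆ p)))
  where
  cover : ∀ {q} → q ⊆ inside ∷ p →
    ∃[ r ] (r ⊆ p × q ≡ outside ∷ r) ⊎ ∃[ r ] (r ⊆ p × q ≡ inside ∷ r)
  cover {inside ∷ q}  q⊆ = inj₂ (q , drop-∷-⊆ q⊆ , refl)
  cover {outside ∷ q} q⊆ = inj₁ (q , drop-∷-⊆ q⊆ , refl)

-- Subsets and their enumeration by tuples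

∣p∪q∣≤∣p∣+∣q∣ : ∀ {n} (p q : Subset n) → ∣ p ∪ q ∣ ≤ ∣ p ∣ + ∣ q ∣
∣p∪q∣≤∣p∣+∣q∣ [] [] = z≤n
∣p∪q∣≤∣p∣+∣q∣ (outside ∷ p) (outside ∷ q) = ∣p∪q∣≤∣p∣+∣q∣ p q
∣p∪q∣≤∣p∣+∣q∣ (outside ∷ p) (inside ∷ q) =
  ≤-trans (s≤s (∣p∪q∣≤∣p∣+∣q∣ p q)) (≤-reflexive (sym (+-suc ∣ p ∣ ∣ q ∣)))
∣p∪q∣≤∣p∣+∣q∣ (inside ∷ p) (outside ∷ q) = s≤s (∣p∪q∣≤∣p∣+∣q∣ p q)
∣p∪q∣≤∣p∣+∣q∣ (inside ∷ p) (inside ∷ q) =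
  s≤s (≤-trans (∣p∪q∣≤∣p∣+∣q∣ p q) (+-monoʳ-≤ ∣ p ∣ (n≤1+n ∣ q ∣)))

module _ {n : ℕ} where

  x∈p∩∁q⁺ : ∀ {x} {p q : Subset n} → x ∈ p → x ∉ q → x ∈ p ∩ ∁ q
  x∈p∩∁q⁺ x∈p x∉q = x∈p∩q⁺ (x∈p , x∉p⇒x∈∁p x∉q)

  x∈p∩∁q⁻ : ∀ {x} (p q : Subset n) → x ∈ p ∩ ∁ q → x ∈ p × x ∉ q
  x∈p∩∁q⁻ p q x∈ with x∈p∩q⁻ p (∁ q) x∈
  ... | x∈p , x∈∁q = x∈p , x∈∁p⇒x∉p x∈∁q

  p∪s∩∁p≡s : ∀ {p s : Subset n} → p ⊆ s → p ∪ (s ∩ ∁ p) ≡ s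
  p∪s∩∁p≡s {p} {s} p⊆s = ⊆-antisym
    (λ x∈ → [ p⊆s , proj₁ ∘ x∈p∩∁q⁻ s p ]′ (x∈p∪q⁻ p (s ∩ ∁ p) x∈))
    (λ {x} x∈s → x∈p∪q⁺ (case x ∈? p of λ
      { (yes x∈p) → inj₁ x∈p ; (no x∉p) → inj₂ (x∈p∩∁q⁺ x∈s x∉p) }))

  p⊆q∧∣q∣≤∣p∣⇒p≡q : ∀ {p q : Subset n} → p ⊆ q → ∣ q ∣ ≤ ∣ p ∣ → p ≡ q
  p⊆q∧∣q∣≤∣p∣⇒p≡q {p} {q} p⊆q ∣q∣≤∣p∣ = ⊆-antisym p⊆q q⊆p
    where
    q⊆p : q ⊆ p
    q⊆p {x} x∈q with x ∈? p
    ... | yes x∈p = x∈p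
    ... | no x∉p = contradiction (p⊂q⇒∣p∣<∣q∣ (p⊆q , x , x∈q , x∉p)) (≤⇒≯ ∣q∣≤∣p∣)

  ∣⁅x⁆∪p∣≤1+∣p∣ : ∀ (x : Fin n) p → ∣ ⁅ x ⁆ ∪ p ∣ ≤ suc ∣ p ∣
  ∣⁅x⁆∪p∣≤1+∣p∣ x p =
    ≤-trans (∣p∪q∣≤∣p∣+∣q∣ ⁅ x ⁆ p) (≤-reflexive (cong (_+ ∣ p ∣) (∣⁅x⁆∣≡1 x)))

  toSet : ∀ {k} → Vec (Fin n) k → Subset n
  toSet []       = ∅
  toSet (x ∷ xs) = ⁅ x ⁆ ∪ toSet xs

  -- A set of at most `k` elements becomes one of the `n ^ k` tuples of length exactly `k`. Once `p`
  -- is exhausted the tuple is padded with `z`, so its entries may leave `p` but not `s`.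
  enumerate : ∀ k {p s : Subset n} → p ⊆ s → Nonempty s → ∣ p ∣ ≤ k →
    Σ (Vec (Fin n) k) λ xs → p ⊆ toSet xs × toSet xs ⊆ s
  enumerate zero {p} p⊆s ne ∣p∣≤0 = [] ,
    (λ x∈p → contradiction (x∈p⇒∣p-x∣<∣p∣ x∈p) (≤⇒≯ (≤-trans ∣p∣≤0 z≤n))) ,
    λ x∈ → contradiction x∈ ∉⊥
  enumerate (suc k) {p} {s} p⊆s (z , z∈s) ∣p∣≤ with pick
    where
    pick : ∃[ y ] (y ∈ s × ∣ p - y ∣ ≤ k)
    pick with nonempty? p
    ... | yes (y , y∈p) = y , p⊆s y∈p , ≤-pred (≤-trans (x∈p⇒∣p-x∣<∣p∣ y∈p) ∣p∣≤)
    ... | no empty = z , z∈s , ≤-trans (∣p─q∣≤∣p∣ p ⁅ z ⁆)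
      (≤-trans (≤-reflexive (trans (cong ∣_∣ (Empty-unique empty)) (∣⊥∣≡0 n))) z≤n)
  ... | y , y∈s , ∣p-y∣≤k with enumerate k (p⊆s ∘ p─q⊆p p ⁅ y ⁆) (z , z∈s) ∣p-y∣≤k
  ...   | xs , p-y⊆xs , xs⊆s = y ∷ xs , p⊆y∷xs , y∷xs⊆s
    where
    p⊆y∷xs : p ⊆ ⁅ y ⁆ ∪ toSet xs
    p⊆y∷xs {x} x∈p with x ≟ y
    ... | yes refl = x∈p∪q⁺ (inj₁ (x∈⁅x⁆ y))
    ... | no x≢y = x∈p∪q⁺ (inj₂ (p-y⊆xs (x∈p∧x≢y⇒x∈p-y x∈p x≢y)))
    y∷xs⊆s : ⁅ y ⁆ ∪ toSet xs ⊆ s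
    y∷xs⊆s x∈ with x∈p∪q⁻ ⁅ y ⁆ (toSet xs) x∈
    ... | inj₁ x∈y = subst (_∈ s) (sym (x∈⁅y⁆⇒x≡y y x∈y)) y∈s
    ... | inj₂ x∈xs = xs⊆s x∈xs

-- Maximal independent sets

Far : ∀ {n} → Graph n → Fin n → Fin n → Set
Far G u w = u ≢ w × adj G u w ≡ false

FarFromEdge : ∀ {n} → Graph n → Fin n → Fin n → Subset n → Set
FarFromEdge G u v Z = adj G u v ≡ true × (∀ {w} → w ∈ Z → Far G u w × Far G v w)

module _ {n} (H : Graph n) where

  far⇒adjᶜ : ∀ {u w} → Far (complement H) u w → adj H u w ≡ true
  far⇒adjᶜ {u} {w} (u≢w , e) with adj H u w | u ≟ w
  ... | true  | _       = refl
  ... | false | yes u≡w = contradiction u≡w u≢w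
  far⇒adjᶜ (_ , ()) | false | no _

  adj⇒nonadjᶜ : ∀ {u v} → adj (complement H) u v ≡ true → adj H u v ≡ false
  adj⇒nonadjᶜ {u} {v} e with adj H u v
  adj⇒nonadjᶜ () | true
  ... | false = refl

adj⇒≢ : ∀ {n} (G : Graph n) {u v} → adj G u v ≡ true → u ≢ v
adj⇒≢ G {u} e refl with () ← trans (sym e) (irrefl G u)

-- Such sets are subsets of `commonNbrs H u v`, which has at most `c ∸ 1` elements because the edge
-- `u v` of `G` is a non-edge of `H`. This is the only use of closedness.
atMost-farFromEdge : ∀ c {n} (G : Graph n) → CoCClosed c G → ∀ u v →
  AtMost (2 ^ (c ∸ 1)) (FarFromEdge G u v)
atMost-farFromEdge c G (H , closed , refl) u v with adj G u v in e
... | false = atMost-∅ λ { (() , _) }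
... | true = atMost-mono
  (^-monoʳ-≤ 2 (closed u v (adj⇒≢ G e) (adj⇒nonadjᶜ H e)))
  (λ { (_ , far) {w} w∈Z → lookup⇒[]= w _ (trans (lookup∘tabulate _ w)
         (cong₂ _∧_ (far⇒adjᶜ H (proj₁ (far w∈Z))) (far⇒adjᶜ H (proj₂ (far w∈Z))))) })
  (atMost-⊆ (commonNbrs H u v))

module _ {n} (G : Graph n) where

  Independent : Subset n → Set
  Independent I = ∀ {x y} → x ∈ I → y ∈ I → adj G x y ≡ false

  Dominated : Subset n → Fin n → Set
  Dominated I x = ∃[ y ] (y ∈ I × adj G x y ≡ true)

  dominated? : ∀ I x → Dec (Dominated I x)
  dominated? I x = any? λ y → y ∈? I ×-dec adj G x y ≟ᵇ true

  undominated : ∀ {I x y} → ¬ Dominated I x → y ∈ I → adj G x y ≡ false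
  undominated nd y∈I = ¬-not λ e → nd (_ , y∈I , e)

  MaxIndependent : List (Fin n) → Subset n → Set
  MaxIndependent vs I = (∀ {x} → x ∈ I → x ∈ₗ vs) × Independent I ×
    (∀ {x} → x ∈ₗ vs → x ∉ I → Dominated I x)

  -- Reverses the deletion of `v`: a set that is still maximal without `v` determines whether `v`
  -- belonged to the larger one.
  extend : Fin n → Subset n → Subset n
  extend v I with dominated? I v
  ... | yes _ = I
  ... | no  _ = ⁅ v ⁆ ∪ I

  -- If I − v is not maximal without v, a witness u is adjacent to v and to nothing else in I.
  maxIndependent-∷ : ∀ {v vs I} → All (v ≢_) vs → MaxIndependent (v ∷ vs) I →
    ∃[ J ] (MaxIndependent vs J × I ≡ extend v J) ⊎
    ∃[ u ] ∃[ Z ] (FarFromEdge G u v Z × I ≡ ⁅ v ⁆ ∪ Z)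
  maxIndependent-∷ {v} {vs} {I} v∉vs (I⊆ , indep , maxl) with
    any? (λ u → ∈ₗ-dec _≟_ u vs ×-dec ¬? (u ∈? J) ×-dec ¬? (dominated? J u))
    where
    J = I ∩ ∁ ⁅ v ⁆
  ... | yes (u , u∈vs , u∉J , u-nd) = inj₂ (u , J , (uv , far) , sym I≡)
    where
    J = I ∩ ∁ ⁅ v ⁆
    u≢v : u ≢ v
    u≢v u≡v = All.lookup v∉vs u∈vs (sym u≡v)
    u∉I : u ∉ I
    u∉I u∈I = u∉J (x∈p∩∁q⁺ u∈I (x≢y⇒x∉⁅y⁆ u≢v))
    only-v : Dominated I u → v ∈ I × adj G u v ≡ true
    only-v (y , y∈I , e) with y ≟ v
    ... | yes refl = y∈I , e
    ... | no y≢v = contradiction (y , x∈p∩∁q⁺ y∈I (x≢y⇒x∉⁅y⁆ y≢v) , e) u-nd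
    v∈I = proj₁ (only-v (maxl (there u∈vs) u∉I))
    uv = proj₂ (only-v (maxl (there u∈vs) u∉I))
    I≡ : ⁅ v ⁆ ∪ J ≡ I
    I≡ = p∪s∩∁p≡s (λ x∈ → subst (_∈ I) (sym (x∈⁅y⁆⇒x≡y v x∈)) v∈I)
    far : ∀ {w} → w ∈ J → Far G u w × Far G v w
    far w∈J with x∈p∩∁q⁻ I ⁅ v ⁆ w∈J
    ... | w∈I , w∉v = ((λ { refl → u∉I w∈I }) , undominated u-nd w∈J) ,
                      ((λ v≡w → x∉⁅y⁆⇒x≢y w∉v (sym v≡w)) , indep v∈I w∈I)
  ... | no none = inj₁ (J , (J⊆ , J-indep , J-max) , I≡)
    where
    J = I ∩ ∁ ⁅ v ⁆
    ∈J⁻ : ∀ {x} → x ∈ J → x ∈ I × x ∉ ⁅ v ⁆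
    ∈J⁻ = x∈p∩∁q⁻ I ⁅ v ⁆
    J⊆ : ∀ {x} → x ∈ J → x ∈ₗ vs
    J⊆ x∈J with ∈J⁻ x∈J
    ... | x∈I , x∉v with I⊆ x∈I
    ...   | here refl = contradiction (x∈⁅x⁆ v) x∉v
    ...   | there x∈vs = x∈vs
    J-indep : Independent J
    J-indep x∈J y∈J = indep (proj₁ (∈J⁻ x∈J)) (proj₁ (∈J⁻ y∈J))
    J-max : ∀ {x} → x ∈ₗ vs → x ∉ J → Dominated J x
    J-max {x} x∈vs x∉J with dominated? J x
    ... | yes d = d
    ... | no nd = contradiction (x , x∈vs , x∉J , nd) none
    I≡ : I ≡ extend v J
    I≡ with dominated? J v
    ... | yes (y , y∈J , e) = ⊆-antisym
      (λ {x} x∈I → x∈p∩∁q⁺ x∈I λ x∈v → contradiction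
        (subst (_∈ I) (x∈⁅y⁆⇒x≡y v x∈v) x∈I) v∉I)
      (proj₁ ∘ ∈J⁻)
      where
      v∉I : v ∉ I
      v∉I v∈I with () ← trans (sym e) (indep v∈I (proj₁ (∈J⁻ y∈J)))
    ... | no nd = sym (p∪s∩∁p≡s λ x∈ → subst (_∈ I) (sym (x∈⁅y⁆⇒x≡y v x∈)) v∈I)
      where
      v∈I : v ∈ I
      v∈I with v ∈? I
      ... | yes v∈I = v∈I
      ... | no v∉I with maxl (here refl) v∉I
      ...   | y , y∈I , e = contradiction
        (y , x∈p∩∁q⁺ y∈I (x≢y⇒x∉⁅y⁆ λ { refl → v∉I y∈I }) , e) nd

  module _ {K : ℕ} (bound : ∀ u v → AtMost K (FarFromEdge G u v)) where

    -- Vertices are added one at a time. `extend v` is a function of the old set, so additional sets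
    -- arise only from pairs of a witness `u` and a set `Z`, at most `n * K` for each `v`; the
    -- initial 1 is the empty set.
    atMost-maxIndependent : ∀ {vs} → Unique vs →
      AtMost (1 + length vs * (n * K)) (MaxIndependent vs)
    atMost-maxIndependent [] = (∅ ∷ []) , ≤-refl ,
      λ { (I⊆ , _) → here (Empty-unique λ { (x , x∈I) → case I⊆ x∈I of λ () }) }
    atMost-maxIndependent {v ∷ vs} (v∉vs ∷ u) = atMost-mono
      (s≤s (≤-reflexive (+-comm (length vs * (n * K)) (n * K))))
      (maxIndependent-∷ v∉vs)
      (atMost-⊎ (atMost-image (extend v) (atMost-maxIndependent u))
        (atMost-∃Fin λ u → atMost-image (⁅ v ⁆ ∪_) (bound u v)))

-- Walks in trees

module _ {V : Set} {E : V → V → Set} where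

  mapWalk : ∀ {F : V → V → Set} → (∀ {x y} → E x y → F x y) → ∀ {u v} → Walk E u v → Walk F u v
  mapWalk f []      = []
  mapWalk f (e ∷ w) = f e ∷ mapWalk f w

  _++ʷ_ : ∀ {u v w} → Walk E u v → Walk E v w → Walk E u w
  []      ++ʷ q = q
  (e ∷ p) ++ʷ q = e ∷ (p ++ʷ q)

  reverseWalk : (∀ {x y} → E x y → E y x) → ∀ {u v} → Walk E u v → Walk E v u
  reverseWalk s []      = []
  reverseWalk s (e ∷ w) = reverseWalk s w ++ʷ (s e ∷ [])

  -- A walk without repeated vertices; the index lists the vertices after the start.
  data Path : V → V → List V → Set where
    []   : ∀ {u} → Path u u []
    cons : ∀ {u v w xs} → E u v → ¬ (u ∈ₗ v ∷ xs) → Path v w xs → Path u w (v ∷ xs)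

  suffix : ∀ {u v w xs} → Path v w xs → u ∈ₗ v ∷ xs → ∃[ ys ] Path u w ys
  suffix p            (here refl) = _ , p
  suffix (cons _ _ p) (there u∈)  = suffix p u∈

module _ {m : ℕ} (T : Graph m) where

  Avoid : Fin m → Fin m → Fin m → Set
  Avoid a = EdgeIn T (_≢ a)

  edge-sym : ∀ {u v} → Edge T u v → Edge T v u
  edge-sym {u} {v} e = trans (adj-sym T v u) e

  avoid-sym : ∀ {a u v} → Avoid a u v → Avoid a v u
  avoid-sym (p , q , e) = q , p , edge-sym e

  avoid-end : ∀ {a u v} → u ≢ a → Walk (Avoid a) u v → v ≢ a
  avoid-end u≢a []                  = u≢a
  avoid-end u≢a ((_ , v≢a , _) ∷ w) = avoid-end v≢a w

  -- Cuts the walk after its last visit to `a`; the first alternative arises if it never visits `a`.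
  lastExit : ∀ {E : Fin m → Fin m → Set} a {u k} → k ≢ a → Walk E u k →
    (u ≢ a × Walk (λ x y → E x y × x ≢ a × y ≢ a) u k) ⊎
    ∃[ c ] (E a c × Walk (λ x y → E x y × x ≢ a × y ≢ a) c k)
  lastExit a k≢a [] = inj₁ (k≢a , [])
  lastExit a {u} k≢a (e ∷ w) with lastExit a k≢a w
  ... | inj₂ r = inj₂ r
  ... | inj₁ (v≢a , w′) with u ≟ a
  ...   | yes refl = inj₂ (_ , e , w′)
  ...   | no u≢a   = inj₁ (u≢a , (e , u≢a , v≢a) ∷ w′)

  walk⇒path : ∀ {E : Fin m → Fin m → Set} {u v} → Walk E u v → ∃[ xs ] Path {E = E} u v xs
  walk⇒path [] = [] , []
  walk⇒path {u = u} (_∷_ {v = v} e w) with walk⇒path w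
  ... | xs , p with ∈ₗ-dec _≟_ u (v ∷ xs)
  ...   | yes u∈ = suffix p u∈
  ...   | no u∉  = v ∷ xs , cons e u∉ p

  path-unique : ∀ {E : Fin m → Fin m → Set} {u v xs} → Path {E = E} u v xs → Unique (u ∷ xs)
  path-unique []            = [] ∷ []
  path-unique (cons _ u∉ p) = All.tabulate (λ { x∈ refl → u∉ x∈ }) ∷ path-unique p

  path-avoids : ∀ {a u v xs} → v ≢ a → Path {E = Avoid a} u v xs → All (a ≢_) (u ∷ xs)
  path-avoids v≢a []                       = (v≢a ∘ sym) ∷ []
  path-avoids v≢a (cons (u≢a , _ , _) _ p) = (u≢a ∘ sym) ∷ path-avoids v≢a p

  path-linked : ∀ {a u v xs} → Edge T v a → Path {E = Avoid a} u v xs →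
    Linked (Edge T) (u ∷ xs ++ [ a ])
  path-linked va []                     = va ∷ [-]
  path-linked va (cons (_ , _ , e) _ p) = e ∷ path-linked va p

  module _ (acyclic : Acyclic T) where

    -- Otherwise a path from `b` to `b′` that misses `a` closes up through `a` to a cycle.
    branch-unique : ∀ {a b b′} → Edge T a b → Edge T a b′ → Walk (Avoid a) b b′ → b ≡ b′
    branch-unique {a} ab ab′ w with walk⇒path w
    ... | [] , [] = refl
    ... | x ∷ xs , p@(cons _ _ _) = ⊥-elim (acyclic (a ∷ _ ∷ x ∷ xs)
      ( s≤s (s≤s (s≤s z≤n))
      , path-avoids (adj⇒≢ T ab′ ∘ sym) p ∷ path-unique p
      , ab ∷ path-linked (edge-sym ab′) p))

    -- Deleting the edge `a b` separates its ends: a walk from `a` to `k` missing `b` finally leaves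
    -- `a` through another neighbour `c`, and `b` and `c` would share a branch at `a`.
    sides-disjoint : ∀ {a b k} → Edge T a b → Walk (Avoid a) b k → ¬ Walk (Avoid b) a k
    sides-disjoint {a} {b} {k} ab bk ak with lastExit a (avoid-end (adj⇒≢ T ab ∘ sym) bk) ak
    ... | inj₁ (a≢a , _) = a≢a refl
    ... | inj₂ (c , (_ , c≢b , ac) , ck) = c≢b (branch-unique ac ab
      (mapWalk (λ { ((_ , _ , e) , p , q) → p , q , e }) ck ++ʷ reverseWalk avoid-sym bk))

    -- Following chosen neighbours without ever turning back never revisits a node, so it must stop.
    mutual-choice : (R : Fin m → Fin m → Set) (C : Fin m → Set) →
      (∀ a → C a → ∃[ b ] (Edge T a b × R a b × C b)) →
      ∀ a → C a → ∃[ x ] ∃[ y ] (Edge T x y × R x y × R y x)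
    mutual-choice R C next a Ca with next a Ca
    ... | b , ab , Rab , Cb = go m ([ a ]) ([] ∷ []) ≤-refl ab Rab Cb ([] ∷ [])
      where
      -- The invariant puts all visited nodes on the `p`-side of the edge `p c`, hence `c` is new.
      -- When the fuel is gone, more than `m` distinct nodes have been visited.
      go : ∀ fuel visited → Unique visited → m < length visited + fuel →
        ∀ {p c} → Edge T p c → R p c → C c → All (λ v → Walk (Avoid c) p v) visited →
        ∃[ x ] ∃[ y ] (Edge T x y × R x y × R y x)
      go zero visited u m< _ _ _ _ = contradiction
        (≤-trans (unique-⊆-length u (λ {x} _ → ∈-allFin x)) (≤-reflexive (length-tabulate {n = m} (λ i → i))))
        (<⇒≱ (≤-trans m< (≤-reflexive (+-identityʳ _))))
      go (suc fuel) visited u m< {p} {c} pc Rpc Cc reach with next c Cc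
      ... | d , cd , Rcd , Cd with d ≟ p
      ...   | yes refl = p , c , pc , Rpc , Rcd
      ...   | no d≢p = go fuel (c ∷ visited)
        (All.map (λ w c≡v → avoid-end (adj⇒≢ T pc) w (sym c≡v)) reach ∷ u)
        (≤-trans m< (≤-reflexive (+-suc (length visited) fuel)))
        cd Rcd Cd ([] ∷ All.map step reach)
        where
        p↛d : ¬ Walk (Avoid c) p d
        p↛d w = d≢p (sym (branch-unique (edge-sym pc) cd w))
        -- If the walk from `p` met `d`, it would join `p` to `d` without passing `c`, against
        -- `branch-unique`. So it misses `d` and can be prolonged backwards to `c`.
        step : ∀ {v} → Walk (Avoid c) p v → Walk (Avoid d) c v
        step w with lastExit d (λ { refl → p↛d w }) w
        ... | inj₁ (p≢d , w′) =
          (adj⇒≢ T cd , p≢d , edge-sym pc) ∷ mapWalk (λ { ((_ , _ , e) , p , q) → p , q , e }) w′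
        ... | inj₂ (x , dx , xv) =
          contradiction (w ++ʷ reverseWalk avoid-sym (dx ∷ mapWalk proj₁ xv)) p↛d

-- Structure of sets of bounded treewidth

-- These conditions let every vertex of `S` outside `X` be hung as a leaf on the bag `X` without
-- raising the width.
record Core {n} (G : Graph n) (t : ℕ) (S X : Subset n) : Set where
  field
    nonempty    : Nonempty X
    X⊆S         : X ⊆ S
    ∣X∣≤1+t     : ∣ X ∣ ≤ suc t
    independent : ∀ {u v} → u ∈ S → u ∉ X → v ∈ S → v ∉ X → adj G u v ≡ false
    nonNeighbour : ∀ {w} → w ∈ S → w ∉ X → ∃[ x ] (x ∈ X × adj G w x ≡ false)

-- `S` is recovered from `X`, two edges and one set far from each edge; `X` will be the intersection
-- of two neighbouring bags.
record Split {n} (G : Graph n) (t : ℕ) (S X : Subset n) (u v u′ v′ : Fin n) : Set where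
  field
    X⊆S   : X ⊆ S
    ∣X∣≤t : ∣ X ∣ ≤ t
    uv    : adj G u v ≡ true
    u′v′  : adj G u′ v′ ≡ true
    cover : ∀ {w} → w ∈ S → w ∈ X ⊎ (Far G u w × Far G v w) ⊎ (Far G u′ w × Far G v′ w)

-- With at most `t` vertices there is room for one more vertex `v` of `S`, which is then a
-- non-neighbour of everything left outside.
independent⇒core : ∀ {n} (G : Graph n) {t S X} → Nonempty S → X ⊆ S → ∣ X ∣ ≤ t →
  (∀ {u v} → u ∈ S → u ∉ X → v ∈ S → v ∉ X → adj G u v ≡ false) → ∃[ Y ] Core G t S Y
independent⇒core G {S = S} {X} ne X⊆S ∣X∣≤t indep with any? (λ v → v ∈? S ×-dec ¬? (v ∈? X))
... | yes (v , v∈S , v∉X) = ⁅ v ⁆ ∪ X , record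
  { nonempty = v , x∈p∪q⁺ (inj₁ (x∈⁅x⁆ v))
  ; X⊆S = λ x∈ → [ (λ x∈v → subst (_∈ S) (sym (x∈⁅y⁆⇒x≡y v x∈v)) v∈S) , X⊆S ]′ (x∈p∪q⁻ ⁅ v ⁆ X x∈)
  ; ∣X∣≤1+t = ≤-trans (∣⁅x⁆∪p∣≤1+∣p∣ v X) (s≤s ∣X∣≤t)
  ; independent = λ u∈ u∉ w∈ w∉ → indep u∈ (u∉ ∘ q⊆p∪q ⁅ v ⁆ X) w∈ (w∉ ∘ q⊆p∪q ⁅ v ⁆ X)
  ; nonNeighbour = λ w∈ w∉ → v , x∈p∪q⁺ (inj₁ (x∈⁅x⁆ v)) , indep w∈ (w∉ ∘ q⊆p∪q ⁅ v ⁆ X) v∈S v∉X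
  }
... | no none = X , record
  { nonempty = proj₁ ne , S⊆X (proj₂ ne)
  ; X⊆S = X⊆S
  ; ∣X∣≤1+t = m≤n⇒m≤1+n ∣X∣≤t
  ; independent = indep
  ; nonNeighbour = λ w∈ w∉ → contradiction (S⊆X w∈) w∉
  }
  where
  S⊆X : S ⊆ X
  S⊆X {x} x∈S with x ∈? X
  ... | yes x∈X = x∈X
  ... | no x∉X = contradiction (x , x∈S , x∉X) none

module _ {n} {G : Graph n} {S : Subset n} {t : ℕ} (D : TreeDecomp G S t) where
  open TreeDecomp D

  acyclic : Acyclic T
  acyclic = proj₂ (proj₂ isTree)

  direction : ∀ {a k} → k ≢ a → ∃[ b ] (Edge T a b × Walk (Avoid T a) b k)
  direction {a} {k} k≢a with lastExit T a k≢a (proj₁ (proj₂ isTree) a k)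
  ... | inj₁ (a≢a , _) = contradiction refl a≢a
  ... | inj₂ (b , ab , w) = b , ab , mapWalk (λ { (e , p , q) → p , q , e }) w

  Behind : Fin n → Fin m → Fin m → Set
  Behind v a b = ∀ q → v ∈ bag q → Walk (Avoid T a) b q

  bag-≢ : ∀ {v a k} → v ∉ bag a → v ∈ bag k → k ≢ a
  bag-≢ v∉a v∈k refl = v∉a v∈k

  -- The nodes whose bags contain `v` are connected and miss `a`, so they lie in a single branch at
  -- `a`; one of them determines which.
  behind : ∀ {v a b k} → v ∈ S → v ∉ bag a → v ∈ bag k → Walk (Avoid T a) b k → Behind v a b
  behind v∈S v∉a v∈k bk q v∈q = bk ++ʷ mapWalk
    (λ { (v∈x , v∈y , e) → bag-≢ v∉a v∈x , bag-≢ v∉a v∈y , e }) (subtree _ v∈S _ q v∈k v∈q)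

  -- The two branches are opposite sides of the edge `a b`, so `u` and `w` share no bag, whereas
  -- equal or adjacent vertices would.
  behind-disjoint : ∀ {u w a b} → u ∈ S → w ∈ S → Edge T a b → Behind u a b → Behind w b a → Far G u w
  behind-disjoint {u} {w} u∈S w∈S ab u-behind w-behind =
    (λ { refl → let q , u∈q = cover u u∈S in apart q u∈q u∈q }) ,
    ¬-not λ e → let q , u∈q , w∈q = edgeCov u w u∈S w∈S e in apart q u∈q w∈q
    where
    apart : ∀ q → u ∈ bag q → ¬ (w ∈ bag q)
    apart q u∈q w∈q = sides-disjoint T acyclic ab (u-behind q u∈q) (w-behind q w∈q)

  -- Suppose `w` is adjacent to the whole of a full bag. Walking from `a` towards a bag of `w`,
  -- every bag met contains `bag a`, hence not `w`, so the walk never arrives; `mutual-choice` then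
  -- yields an edge with the target on both sides.
  bag-nonNeighbour : ∀ {a w} → w ∈ S → w ∉ bag a → t < ∣ bag a ∣ →
    ∃[ x ] (x ∈ bag a × adj G w x ≡ false)
  bag-nonNeighbour {a} {w} w∈S w∉a t<∣a∣ with any? (λ x → x ∈? bag a ×-dec adj G w x ≟ᵇ false)
  ... | yes found = found
  ... | no none = contradiction (mutual-choice T acyclic R C next a (λ x∈ → x∈))
    λ { (x , y , xy , Rxy , Ryx) → sides-disjoint T acyclic xy Rxy Ryx }
    where
    k = proj₁ (cover w w∈S)
    w∈k = proj₂ (cover w w∈S)
    R = λ x y → Walk (Avoid T x) y k
    C : Fin m → Set
    C x = bag a ⊆ bag x
    -- Containing both `bag a` and `w`, `bag x` would have more than `t + 1` elements.
    w∉ : ∀ {x} → C x → w ∉ bag x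
    w∉ {x} a⊆x w∈x = <⇒≱ (≤-trans (s≤s t<∣a∣) (p⊂q⇒∣p∣<∣q∣ (a⊆x , w , w∈x , w∉a))) (width x)
    next : ∀ x → C x → ∃[ y ] (Edge T x y × R x y × C y)
    next x a⊆x with direction (bag-≢ (w∉ a⊆x) w∈k)
    ... | y , xy , yk = y , xy , yk , a⊆y
      where
      a⊆y : bag a ⊆ bag y
      a⊆y {z} z∈a with edgeCov w z w∈S (bag⊆S a z∈a) (¬-not λ e → none (z , z∈a , e))
      -- All bags of `w`, in particular that of `q`, lie beyond `y` from `x`. The subtree of `z`
      -- leads from `x` to `q`, and its first node after the last visit to `x` must be `y`.
      ... | q , w∈q , z∈q with lastExit T x (bag-≢ (w∉ a⊆x) w∈q) (subtree z (bag⊆S a z∈a) x q (a⊆x z∈a) z∈q)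
      ...   | inj₁ (x≢x , _) = contradiction refl x≢x
      ...   | inj₂ (c , (_ , z∈c , xc) , cq) = subst (λ c → z ∈ bag c) c≡y z∈c
        where
        c≡y : c ≡ y
        c≡y = branch-unique T acyclic xc xy
          (mapWalk (λ { ((_ , _ , e) , p , q) → p , q , e }) cq ++ʷ
           reverseWalk (avoid-sym T) (behind w∈S (w∉ a⊆x) w∈k yk q w∈q))

  OutsideEdge : Subset n → Set
  OutsideEdge X = ∃[ u ] ∃[ v ] ((u ∈ S × u ∉ X) × (v ∈ S × v ∉ X) × adj G u v ≡ true)

  outsideEdge? : ∀ X → Dec (OutsideEdge X)
  outsideEdge? X = any? λ u → any? λ v →
    (u ∈? S ×-dec ¬? (u ∈? X)) ×-dec (v ∈? S ×-dec ¬? (v ∈? X)) ×-dec adj G u v ≟ᵇ true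

  -- Compares results of the decision procedure, not arbitrary witnesses: equal bags choose the same
  -- edge.
  choice-determined : ∀ {X Y} → X ≡ Y → {e : OutsideEdge X} {f : OutsideEdge Y} →
    outsideEdge? X ≡ yes e → outsideEdge? Y ≡ yes f → proj₁ e ≡ proj₁ f
  choice-determined refl p q with refl ← trans (sym p) q = refl

  -- The edge outside a bag is a function of the bag, so equal bags never point at each other.
  core-or-split : Nonempty S →
    ∃[ X ] Core G t S X ⊎
    ∃[ X ] ∃[ u ] ∃[ v ] ∃[ u′ ] ∃[ v′ ] Split G t S X u v u′ v′
  core-or-split ne with any? (λ a → ¬? (outsideEdge? (bag a)))
  ... | yes (a , none) = inj₁ core
    where
    indep : ∀ {u v} → u ∈ S → u ∉ bag a → v ∈ S → v ∉ bag a → adj G u v ≡ false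
    indep u∈ u∉ v∈ v∉ = ¬-not λ e → none (_ , _ , (u∈ , u∉) , (v∈ , v∉) , e)
    core : ∃[ X ] Core G t S X
    core with ∣ bag a ∣ ≤? t
    ... | yes ∣a∣≤t = independent⇒core G ne (bag⊆S a) ∣a∣≤t indep
    ... | no ∣a∣≰t with nonempty? (bag a)
    ...   | no empty = contradiction
      (≤-trans (≤-reflexive (trans (cong ∣_∣ (Empty-unique empty)) (∣⊥∣≡0 n))) z≤n) ∣a∣≰t
    ...   | yes a≢∅ = bag a , record
      { nonempty = a≢∅ ; X⊆S = bag⊆S a ; ∣X∣≤1+t = width a ; independent = indep
      ; nonNeighbour = λ w∈S w∉a → bag-nonNeighbour w∈S w∉a (≰⇒> ∣a∣≰t) }
  ... | no all-outside = inj₂ split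
    where
    -- The equation pins `e` down as the edge chosen for `bag a`; this later rules out equal bags.
    R : Fin m → Fin m → Set
    R a b = Σ (OutsideEdge (bag a)) λ e → outsideEdge? (bag a) ≡ yes e ×
      Behind (proj₁ e) a b × Behind (proj₁ (proj₂ e)) a b
    next : ∀ a → ⊤ → ∃[ b ] (Edge T a b × R a b × ⊤)
    next a _ with outsideEdge? (bag a) in eq
    ... | no none = contradiction (a , none) all-outside
    ... | yes e@(u , v , (u∈S , u∉a) , (v∈S , v∉a) , uv) with edgeCov u v u∈S v∈S uv
    ...   | k , u∈k , v∈k with direction (bag-≢ u∉a u∈k)
    ...     | b , ab , bk = b , ab ,
      (e , refl , behind u∈S u∉a u∈k bk , behind v∈S v∉a v∈k bk) , tt
    root : Fin m
    root = proj₁ (cover (proj₁ ne) (proj₂ ne))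
    split : ∃[ X ] ∃[ u ] ∃[ v ] ∃[ u′ ] ∃[ v′ ] Split G t S X u v u′ v′
    split with mutual-choice T acyclic R (λ _ → ⊤) next root tt
    ... | a , b , ab , (e@(u , v , (u∈S , u∉a) , (v∈S , v∉a) , uv) , e-chosen , u-behind , v-behind)
                     , (f@(u′ , v′ , (u′∈S , u′∉b) , (v′∈S , v′∉b) , u′v′) , f-chosen , u′-behind , v′-behind)
      = bag a ∩ bag b , u , v , u′ , v′ , record
        { X⊆S = bag⊆S a ∘ p∩q⊆p (bag a) (bag b)
        -- Bags have at most `t + 1` elements, so an intersection of more than `t` would equal both
        -- bags.
        ; ∣X∣≤t = ≮⇒≥ λ t<∣X∣ → distinct (trans
            (sym (p⊆q∧∣q∣≤∣p∣⇒p≡q (p∩q⊆p (bag a) (bag b)) (≤-trans (width a) t<∣X∣)))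
            (p⊆q∧∣q∣≤∣p∣⇒p≡q (p∩q⊆q (bag a) (bag b)) (≤-trans (width b) t<∣X∣)))
        ; uv = uv ; u′v′ = u′v′ ; cover = covered }
      where
      ba = edge-sym T ab
      distinct : bag a ≢ bag b
      distinct eq with refl ← choice-determined eq e-chosen f-chosen =
        proj₁ (behind-disjoint u∈S u′∈S ab u-behind u′-behind) refl
      far-uv : ∀ {w} → w ∈ S → Behind w b a → Far G u w × Far G v w
      far-uv w∈S w-behind = behind-disjoint u∈S w∈S ab u-behind w-behind ,
                            behind-disjoint v∈S w∈S ab v-behind w-behind
      far-u′v′ : ∀ {w} → w ∈ S → Behind w a b → Far G u′ w × Far G v′ w
      far-u′v′ w∈S w-behind = behind-disjoint u′∈S w∈S ba u′-behind w-behind ,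
                              behind-disjoint v′∈S w∈S ba v′-behind w-behind
      covered : ∀ {w} → w ∈ S → w ∈ bag a ∩ bag b ⊎ (Far G u w × Far G v w) ⊎ (Far G u′ w × Far G v′ w)
      -- The edge `u v` lies on the `b`-side and `u′ v′` on the `a`-side. A vertex `w` missing from
      -- one of the two bags lies on a definite side and is far from the edge on the other.
      covered {w} w∈S with w ∈? bag a | w ∈? bag b
      ... | yes w∈a | yes w∈b = inj₁ (x∈p∩q⁺ (w∈a , w∈b))
      ... | yes w∈a | no w∉b = inj₂ (inj₁ (far-uv w∈S (behind w∈S w∉b w∈a [])))
      ... | no w∉a | yes w∈b = inj₂ (inj₂ (far-u′v′ w∈S (behind w∈S w∉a w∈b [])))
      ... | no w∉a | no w∉b with cover w w∈S
      ...   | k , w∈k with direction (bag-≢ w∉a w∈k)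
      ...     | c , ac , ck with c ≟ b
      ...       | yes refl = inj₂ (inj₂ (far-u′v′ w∈S (behind w∈S w∉a w∈k ck)))
      -- If the walk from `c` met `b`, then `c` and `b` would share a branch at `a`. So it misses
      -- `b`, and `w` is on the `a`-side.
      ...       | no c≢b with lastExit T b (bag-≢ w∉b w∈k) ck
      ...         | inj₁ (_ , ck′) = inj₂ (inj₁ (far-uv w∈S (behind w∈S w∉b w∈k
                      ((adj⇒≢ T ab , c≢b , ac) ∷ mapWalk (λ { ((_ , _ , e) , p , q) → p , q , e }) ck′))))
      ...         | inj₂ (d , bd , dk) = contradiction
                      (branch-unique T acyclic ac ab
                        (ck ++ʷ reverseWalk (avoid-sym T) (bd ∷ mapWalk proj₁ dk))) c≢b

-- Star decompositions

star : ∀ n → Graph (suc n)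
star n = record { adj = edge ; sym = edge-symmetric ; irrefl = edge-irrefl }
  where
  edge : Fin (suc n) → Fin (suc n) → Bool
  edge zero    zero    = false
  edge zero    (suc _) = true
  edge (suc _) zero    = true
  edge (suc _) (suc _) = false
  edge-symmetric : ∀ u v → edge u v ≡ edge v u
  edge-symmetric zero    zero    = refl
  edge-symmetric zero    (suc _) = refl
  edge-symmetric (suc _) zero    = refl
  edge-symmetric (suc _) (suc _) = refl
  edge-irrefl : ∀ v → edge v v ≡ false
  edge-irrefl zero    = refl
  edge-irrefl (suc _) = refl

star-connected : ∀ n → Connected (star n)
star-connected n zero    zero    = []
star-connected n zero    (suc j) = refl ∷ []
star-connected n (suc i) zero    = refl ∷ []
star-connected n (suc i) (suc j) = _∷_ {v = zero} refl (refl ∷ [])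

-- Edges join the centre to leaves, so a closed list of length at least 3 has two leaves in a row or
-- repeats the centre.
star-acyclic : ∀ n → Acyclic (star n)
star-acyclic n (x ∷ []) (s≤s () , _)
star-acyclic n (x ∷ y ∷ []) (s≤s (s≤s ()) , _)
star-acyclic n (zero  ∷ suc _ ∷ zero ∷ zs) (_ , (_ ∷ x≢z ∷ _) ∷ _ , _) = x≢z refl
star-acyclic n (zero  ∷ zero  ∷ zs) (_ , _ , () ∷ _)
star-acyclic n (zero  ∷ suc _ ∷ suc _ ∷ zs) (_ , _ , _ ∷ () ∷ _)
star-acyclic n (suc _ ∷ suc _ ∷ zs) (_ , _ , () ∷ _)
star-acyclic n (suc _ ∷ zero ∷ zero ∷ zs) (_ , _ , _ ∷ () ∷ _)
star-acyclic n (suc _ ∷ zero ∷ suc _ ∷ []) (_ , _ , _ ∷ _ ∷ () ∷ _)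
star-acyclic n (suc _ ∷ zero ∷ suc _ ∷ suc _ ∷ zs) (_ , _ , _ ∷ _ ∷ () ∷ _)
star-acyclic n (suc _ ∷ zero ∷ suc _ ∷ zero ∷ zs) (_ , _ ∷ (_ ∷ y≢ ∷ _) ∷ _ , _) = y≢ refl

module _ {n} {P : Fin n → Set} (P? : ∀ x → Dec (P x)) where

  select : Subset n
  select = tabulate (does ∘ P?)

  ∈-select⁺ : ∀ {x} → P x → x ∈ select
  ∈-select⁺ {x} p = lookup⇒[]= x _ (trans (lookup∘tabulate _ x) (dec-true (P? x) p))

  ∈-select⁻ : ∀ {x} → x ∈ select → P x
  ∈-select⁻ {x} x∈ with P? x | trans (sym (lookup∘tabulate (does ∘ P?) x)) ([]=⇒lookup x∈)
  ... | yes p | _ = p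

module _ {n} (G : Graph n) where

  adjacent? : ∀ v x → Dec (adj G v x ≡ true)
  adjacent? v x = adj G v x ≟ᵇ true

  neighbours : Fin n → Subset n
  neighbours v = select (adjacent? v)

  core⇒treeDecomp : ∀ {t S X} → Core G t S X → TreeDecomp G S t
  core⇒treeDecomp {t} {S} {X} core = record
    { m       = suc n
    ; T       = star n
    ; isTree  = s≤s z≤n , star-connected n , star-acyclic n
    ; bag     = bag
    ; bag⊆S   = bag⊆S
    ; width   = width
    ; cover   = cover
    ; edgeCov = edgeCov
    ; subtree = subtree
    }
    where
    open Core core

    -- The other leaves stay empty, so that the same star serves every `S`.
    leaf : Fin n → Subset n
    leaf w with w ∈? S ∩ ∁ X
    ... | yes _ = ⁅ w ⁆ ∪ (X ∩ neighbours w)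
    ... | no _  = ∅

    leaf⁻ : ∀ w {x} → x ∈ leaf w → (w ∈ S × w ∉ X) × (x ≡ w ⊎ x ∈ X)
    leaf⁻ w x∈ with w ∈? S ∩ ∁ X
    ... | no _ = contradiction x∈ ∉⊥
    ... | yes w∈ with x∈p∪q⁻ ⁅ w ⁆ (X ∩ neighbours w) x∈
    ...   | inj₁ x∈w = x∈p∩∁q⁻ S X w∈ , inj₁ (x∈⁅y⁆⇒x≡y w x∈w)
    ...   | inj₂ x∈X∩N = x∈p∩∁q⁻ S X w∈ , inj₂ (p∩q⊆p X (neighbours w) x∈X∩N)

    leaf⁺ : ∀ {w x} → w ∈ S → w ∉ X → x ≡ w ⊎ (x ∈ X × adj G w x ≡ true) → x ∈ leaf w
    leaf⁺ {w} w∈S w∉X h with w ∈? S ∩ ∁ X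
    ... | no w∉ = contradiction (x∈p∩∁q⁺ w∈S w∉X) w∉
    leaf⁺ _ _ (inj₁ refl) | yes _ = x∈p∪q⁺ (inj₁ (x∈⁅x⁆ _))
    leaf⁺ {w} _ _ (inj₂ (x∈X , e)) | yes _ = x∈p∪q⁺ (inj₂ (x∈p∩q⁺ (x∈X , ∈-select⁺ (adjacent? w) e)))

    bag : Fin (suc n) → Subset n
    bag zero    = X
    bag (suc w) = leaf w

    bag⊆S : ∀ i → bag i ⊆ S
    bag⊆S zero = X⊆S
    bag⊆S (suc w) x∈ with leaf⁻ w x∈
    ... | (w∈S , _) , inj₁ refl = w∈S
    ... | _ , inj₂ x∈X = X⊆S x∈X

    width : ∀ i → ∣ bag i ∣ ≤ suc t
    width zero = ∣X∣≤1+t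
    width (suc w) with w ∈? S ∩ ∁ X
    ... | no _ = ≤-trans (≤-reflexive (∣⊥∣≡0 n)) z≤n
    ... | yes w∈ with x∈p∩∁q⁻ S X w∈
    ...   | w∈S , w∉X with nonNeighbour w∈S w∉X
    -- Adding `w` is paid for by its non-neighbour `x`, which the leaf omits.
    ...     | x , x∈X , wx = ≤-trans (∣⁅x⁆∪p∣≤1+∣p∣ w (X ∩ neighbours w))
      (≤-trans (p⊂q⇒∣p∣<∣q∣ (p∩q⊆p X (neighbours w) , x , x∈X , x∉)) ∣X∣≤1+t)
      where
      x∉ : x ∉ X ∩ neighbours w
      x∉ x∈ with () ← trans (sym wx) (∈-select⁻ (adjacent? w) (p∩q⊆q X (neighbours w) x∈))

    cover : ∀ v → v ∈ S → ∃[ i ] v ∈ bag i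
    cover v v∈S with v ∈? X
    ... | yes v∈X = zero , v∈X
    ... | no v∉X = suc v , leaf⁺ v∈S v∉X (inj₁ refl)

    edgeCov : ∀ u v → u ∈ S → v ∈ S → adj G u v ≡ true → ∃[ i ] (u ∈ bag i × v ∈ bag i)
    edgeCov u v u∈S v∈S e with u ∈? X | v ∈? X
    ... | yes u∈X | yes v∈X = zero , u∈X , v∈X
    ... | yes u∈X | no v∉X =
      suc v , leaf⁺ v∈S v∉X (inj₂ (u∈X , trans (adj-sym G v u) e)) , leaf⁺ v∈S v∉X (inj₁ refl)
    ... | no u∉X | yes v∈X =
      suc u , leaf⁺ u∈S u∉X (inj₁ refl) , leaf⁺ u∈S u∉X (inj₂ (v∈X , e))
    ... | no u∉X | no v∉X with () ← trans (sym e) (independent u∈S u∉X v∈S v∉X)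

    subtree : ∀ v → v ∈ S → ∀ i j → v ∈ bag i → v ∈ bag j →
      Walk (EdgeIn (star n) (λ k → v ∈ bag k)) i j
    subtree v _ i j v∈i v∈j with v ∈? X
    ... | yes v∈X = to-centre i v∈i ++ʷ from-centre j v∈j
      where
      to-centre : ∀ i → v ∈ bag i → Walk (EdgeIn (star n) (λ k → v ∈ bag k)) i zero
      to-centre zero    _   = []
      to-centre (suc i) v∈i = (v∈i , v∈X , refl) ∷ []
      from-centre : ∀ j → v ∈ bag j → Walk (EdgeIn (star n) (λ k → v ∈ bag k)) zero j
      from-centre zero    _   = []
      from-centre (suc j) v∈j = (v∈X , v∈j , refl) ∷ []
    -- A vertex outside `X` occurs in its own leaf only, so `i` and `j` coincide.
    ... | no v∉X = subst (Walk _ i) (trans (own i v∈i) (sym (own j v∈j))) []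
      where
      own : ∀ i → v ∈ bag i → i ≡ suc v
      own zero v∈X = contradiction v∈X v∉X
      own (suc i) v∈i with leaf⁻ i v∈i
      ... | _ , inj₁ refl = refl
      ... | _ , inj₂ v∈X = contradiction v∈X v∉X

  -- Encoding maximal sets

  maximal⇒nonempty : ∀ {t S} → 1 ≤ n → MaximalTw G t S → Nonempty S
  maximal⇒nonempty {t} {S} (s≤s z≤n) (_ , maximal) with nonempty? S
  ... | yes ne = ne
  -- A singleton is its own core, so the empty set is not maximal.
  ... | no empty = zero , maximal ⁅ zero ⁆ (λ x∈S → contradiction (_ , x∈S) empty)
    (core⇒treeDecomp {X = ⁅ zero ⁆} record
      { nonempty     = zero , x∈⁅x⁆ zero
      ; X⊆S          = λ x∈ → x∈
      ; ∣X∣≤1+t      = ≤-trans (≤-reflexive (∣⁅x⁆∣≡1 {n} zero)) (s≤s z≤n)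
      ; independent  = λ x∈ x∉ _ _ → contradiction x∈ x∉
      ; nonNeighbour = λ x∈ x∉ → contradiction x∈ x∉
      }) (x∈⁅x⁆ zero)

  attachable? : ∀ X w → Dec (w ∉ X × ∃[ x ] (x ∈ X × adj G w x ≡ false))
  attachable? X w = ¬? (w ∈? X) ×-dec any? (λ x → x ∈? X ×-dec adj G w x ≟ᵇ false)

  -- Computed from `X` alone, so that `X` and a maximal independent set within this list determine
  -- `S`.
  attachable : Subset n → List (Fin n)
  attachable X = filter (attachable? X) (allFin n)

  -- An attachable vertex outside `S` with no neighbour in `S ∩ ∁ X` could join `S` with `X` still a
  -- core, against maximality.
  core⇒maxIndependent : ∀ {t S X} → MaximalTw G t S → Core G t S X →
    MaxIndependent G (attachable X) (S ∩ ∁ X)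
  core⇒maxIndependent {t} {S} {X} (_ , maximal) core = ⊆attachable , indep , dominating
    where
    open Core core
    ⊆attachable : ∀ {x} → x ∈ S ∩ ∁ X → x ∈ₗ attachable X
    ⊆attachable {x} x∈ with x∈p∩∁q⁻ S X x∈
    ... | x∈S , x∉X = ∈-filter⁺ (attachable? X) (∈-allFin x) (x∉X , nonNeighbour x∈S x∉X)
    indep : Independent G (S ∩ ∁ X)
    indep x∈ y∈ with x∈p∩∁q⁻ S X x∈ | x∈p∩∁q⁻ S X y∈
    ... | x∈S , x∉X | y∈S , y∉X = independent x∈S x∉X y∈S y∉X
    dominating : ∀ {w} → w ∈ₗ attachable X → w ∉ S ∩ ∁ X → Dominated G (S ∩ ∁ X) w
    dominating {w} w∈ w∉ with dominated? G (S ∩ ∁ X) w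
    ... | yes d = d
    ... | no nd = contradiction (x∈p∩∁q⁺ w∈S w∉X) w∉
      where
      w∉X = proj₁ (proj₂ (∈-filter⁻ (attachable? X) {xs = allFin n} w∈))
      S′ = ⁅ w ⁆ ∪ S
      S′⁻ : ∀ {x} → x ∈ S′ → x ≡ w ⊎ x ∈ S
      S′⁻ x∈ = [ inj₁ ∘ x∈⁅y⁆⇒x≡y w , inj₂ ]′ (x∈p∪q⁻ ⁅ w ⁆ S x∈)
      independent′ : ∀ {u v} → u ∈ S′ → u ∉ X → v ∈ S′ → v ∉ X → adj G u v ≡ false
      independent′ {u} {v} u∈ u∉X v∈ v∉X with S′⁻ u∈ | S′⁻ v∈
      ... | inj₁ refl | inj₁ refl = irrefl G w
      ... | inj₁ refl | inj₂ v∈S = undominated G nd (x∈p∩∁q⁺ v∈S v∉X)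
      ... | inj₂ u∈S | inj₁ refl = trans (adj-sym G u w) (undominated G nd (x∈p∩∁q⁺ u∈S u∉X))
      ... | inj₂ u∈S | inj₂ v∈S = independent u∈S u∉X v∈S v∉X
      nonNeighbour′ : ∀ {v} → v ∈ S′ → v ∉ X → ∃[ x ] (x ∈ X × adj G v x ≡ false)
      nonNeighbour′ v∈ v∉X with S′⁻ v∈
      ... | inj₁ refl = proj₂ (proj₂ (∈-filter⁻ (attachable? X) {xs = allFin n} w∈))
      ... | inj₂ v∈S = nonNeighbour v∈S v∉X
      w∈S : w ∈ S
      w∈S = maximal S′ (q⊆p∪q ⁅ w ⁆ S) (core⇒treeDecomp {X = X} record
        { nonempty = nonempty ; X⊆S = q⊆p∪q ⁅ w ⁆ S ∘ X⊆S ; ∣X∣≤1+t = ∣X∣≤1+t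
        ; independent = independent′ ; nonNeighbour = nonNeighbour′ })
        (x∈p∪q⁺ (inj₁ (x∈⁅x⁆ w)))

  module _ {K : ℕ} (bound : ∀ u v → AtMost K (FarFromEdge G u v)) (t : ℕ) where

    atMost-core : AtMost (n ^ suc t * (1 + n * (n * K))) (λ S → MaximalTw G t S × ∃[ X ] Core G t S X)
    atMost-core = atMost-mono ≤-refl encode (atMost-∃Vec (suc t) λ xs →
      atMost-image (toSet xs ∪_) (atMost-mono
        (s≤s (*-monoˡ-≤ (n * K) (≤-trans (length-filter (attachable? (toSet xs)) (allFin n))
                                         (≤-reflexive (length-tabulate {n = n} (λ i → i))))))
        (λ h → h)
        (atMost-maxIndependent G bound (filter⁺ (attachable? (toSet xs)) (allFin⁺ n)))))
      where
      encode : ∀ {S} → MaximalTw G t S × ∃[ X ] Core G t S X →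
        ∃[ xs ] ∃[ I ] (MaxIndependent G (attachable (toSet {k = suc t} xs)) I × S ≡ toSet xs ∪ I)
      encode {S} (maximal , X , core)
        -- Padding stays inside `X`, so the tuple gives back exactly `X`, on which the list of
        -- attachable vertices depends.
        with enumerate (suc t) (λ x∈ → x∈) (Core.nonempty core) (Core.∣X∣≤1+t core)
      ... | xs , X⊆xs , xs⊆X with refl ← ⊆-antisym X⊆xs xs⊆X =
        xs , S ∩ ∁ (toSet xs) , core⇒maxIndependent maximal core , sym (p∪s∩∁p≡s (Core.X⊆S core))

    atMost-split : AtMost (n ^ t * (n * (n * (n * (n * (K * K))))))
      (λ S → Nonempty S × ∃[ X ] ∃[ u ] ∃[ v ] ∃[ u′ ] ∃[ v′ ] Split G t S X u v u′ v′)
    atMost-split = atMost-mono ≤-refl encode (atMost-∃Vec t λ xs →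
      atMost-∃Fin λ u → atMost-∃Fin λ v → atMost-∃Fin λ u′ → atMost-∃Fin λ v′ →
      atMost-∃ (bound u v) λ Z → atMost-image (λ Z′ → toSet xs ∪ (Z ∪ Z′)) (bound u′ v′))
      where
      encode : ∀ {S} → Nonempty S × ∃[ X ] ∃[ u ] ∃[ v ] ∃[ u′ ] ∃[ v′ ] Split G t S X u v u′ v′ →
        ∃[ xs ] ∃[ u ] ∃[ v ] ∃[ u′ ] ∃[ v′ ] ∃[ Z ] (FarFromEdge G u v Z ×
          ∃[ Z′ ] (FarFromEdge G u′ v′ Z′ × S ≡ toSet {k = t} xs ∪ (Z ∪ Z′)))
      encode {S} (ne , X , u , v , u′ , v′ , split)
        -- Here `X` may be empty, so padding is taken from all of `S`; this is harmless in a union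
        -- equal to `S`.
        with enumerate t (Split.X⊆S split) ne (Split.∣X∣≤t split)
      ... | xs , X⊆xs , xs⊆S = xs , u , v , u′ , v′ ,
        Z , (uv , Z-far) , Z′ , (u′v′ , Z′-far) , ⊆-antisym S⊆ ⊆S
        where
        open Split split
        far? : ∀ u v w → Dec (Far G u w × Far G v w)
        far? u v w = (¬? (u ≟ w) ×-dec adj G u w ≟ᵇ false) ×-dec (¬? (v ≟ w) ×-dec adj G v w ≟ᵇ false)
        far : Fin n → Fin n → Subset n
        far u v = select (far? u v)
        Z = S ∩ far u v
        Z′ = S ∩ far u′ v′
        Z-far : ∀ {w} → w ∈ Z → Far G u w × Far G v w
        Z-far = ∈-select⁻ (far? u v) ∘ p∩q⊆q S (far u v)
        Z′-far : ∀ {w} → w ∈ Z′ → Far G u′ w × Far G v′ w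
        Z′-far = ∈-select⁻ (far? u′ v′) ∘ p∩q⊆q S (far u′ v′)
        S⊆ : S ⊆ toSet xs ∪ (Z ∪ Z′)
        S⊆ w∈S with cover w∈S
        ... | inj₁ w∈X = x∈p∪q⁺ (inj₁ (X⊆xs w∈X))
        ... | inj₂ (inj₁ h) = x∈p∪q⁺ (inj₂ (x∈p∪q⁺ (inj₁ (x∈p∩q⁺ (w∈S , ∈-select⁺ (far? u v) h)))))
        ... | inj₂ (inj₂ h) = x∈p∪q⁺ (inj₂ (x∈p∪q⁺ (inj₂ (x∈p∩q⁺ (w∈S , ∈-select⁺ (far? u′ v′) h)))))
        ⊆S : toSet xs ∪ (Z ∪ Z′) ⊆ S
        ⊆S w∈ with x∈p∪q⁻ (toSet xs) (Z ∪ Z′) w∈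
        ... | inj₁ w∈xs = xs⊆S w∈xs
        ... | inj₂ w∈Z∪Z′ with x∈p∪q⁻ Z Z′ w∈Z∪Z′
        ...   | inj₁ w∈Z = p∩q⊆p S (far u v) w∈Z
        ...   | inj₂ w∈Z′ = p∩q⊆p S (far u′ v′) w∈Z′

-- The final count

count-≤ : ∀ {n} t k → 1 ≤ n →
  n ^ suc t * (1 + n * (n * 2 ^ k)) + n ^ t * (n * (n * (n * (n * (2 ^ k * 2 ^ k))))) ≤
  3 * n ^ (t + 4) * 2 ^ (2 * k)
count-≤ {n} t k 1≤n = begin
  n ^ suc t * (1 + n * (n * K)) + n ^ t * (n * q) ≤⟨ +-monoˡ-≤ _ (*-monoʳ-≤ (n ^ suc t) (+-mono-≤ 1≤q nnK≤q)) ⟩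
  n ^ suc t * (q + q) + n ^ t * (n * q)           ≡⟨ identity n (n ^ t) K ⟩
  3 * (n ^ t * n ^ 4) * (K * K)                   ≡⟨ cong₂ (λ x y → 3 * x * y) (sym (^-distribˡ-+-* n t 4)) K*K≡ ⟩
  3 * n ^ (t + 4) * 2 ^ (2 * k)                   ∎
  where
  open ≤-Reasoning
  K = 2 ^ k
  -- The terms `1` and `n * (n * K)` of the core case are each at most `q`, and the split case
  -- contributes a third `n ^ suc t * q`; hence the factor 3.
  q = n * (n * (n * (K * K)))
  1≤K : 1 ≤ K
  1≤K = m^n>0 2 k
  nnK≤q : n * (n * K) ≤ q
  nnK≤q = *-monoʳ-≤ n (*-monoʳ-≤ n (≤-trans (≤-reflexive (sym (trans (*-identityˡ _) (*-identityˡ K))))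
    (*-mono-≤ 1≤n (*-monoˡ-≤ K 1≤K))))
  1≤q : 1 ≤ q
  1≤q = ≤-trans (*-mono-≤ 1≤n (*-mono-≤ 1≤n 1≤K)) nnK≤q
  K*K≡ : K * K ≡ 2 ^ (2 * k)
  K*K≡ = trans (sym (^-distribˡ-+-* 2 k k)) (cong (λ x → 2 ^ (k + x)) (sym (+-identityʳ k)))
  identity : ∀ n p K → n * p * (n * (n * (n * (K * K))) + n * (n * (n * (K * K)))) +
    p * (n * (n * (n * (n * (K * K))))) ≡ 3 * (p * n ^ 4) * (K * K)
  identity = solve 3 (λ n p K → n :* p :* (n :* (n :* (n :* (K :* K))) :+ n :* (n :* (n :* (K :* K)))) :+
    p :* (n :* (n :* (n :* (n :* (K :* K))))) := con 3 :* (p :* n :^ 4) :* (K :* K)) refl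
    where open +-*-Solver

theorem14 : (c t n : ℕ) → 1 ≤ c → 1 ≤ t → 1 ≤ n → (G : Graph n) → CoCClosed c G →
    (L : List (Subset n)) → Unique L → All (MaximalTw G t) L →
    length L ≤ 3 * n ^ (t + 4) * 2 ^ (2 * (c ∸ 1))
theorem14 c t n _ _ 1≤n G coClosed L unique maximal =
  unique-length≤ (atMost-mono (count-≤ t (c ∸ 1) 1≤n) classify
    (atMost-⊎ (atMost-core G bound t) (atMost-split G bound t))) unique maximal
  where
  bound : ∀ u v → AtMost (2 ^ (c ∸ 1)) (FarFromEdge G u v)
  bound = atMost-farFromEdge c G coClosed
  classify : ∀ {S} → MaximalTw G t S → (MaximalTw G t S × ∃[ X ] Core G t S X) ⊎
    (Nonempty S × ∃[ X ] ∃[ u ] ∃[ v ] ∃[ u′ ] ∃[ v′ ] Split G t S X u v u′ v′)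
  classify maxS@(D , _) with core-or-split D (maximal⇒nonempty G 1≤n maxS)
  ... | inj₁ core  = inj₁ (maxS , core)
  ... | inj₂ split = inj₂ (maximal⇒nonempty G 1≤n maxS , split)
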